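{- On the class of linear orders, $\mathrm{FO}^3(<,\mathrm{succ},\mathrm{min},\mathrm{max})$-sentences are $O(m^4)$-succinct in $\mathrm{FO}^2(<)$-sentences. That is, there is a function $f\colon\mathbb{N}\to\mathbb{N}$ with $f(m)=O(m^4)$ such that for every $\mathrm{FO}^3(<,\mathrm{succ},\mathrm{min},\mathrm{max})$-sentence $\psi$ there is an $\mathrm{FO}^2(<)$-sentence $\chi$ with $|\chi|\le f(|\psi|)$ such that for all $N\in\mathbb{N}$: $\mathcal{A}_N\models\chi$ iff $\mathcal{A}_N\models\psi$.
   Context: For $N\in\mathbb{N}$, $\mathcal{A}_N$ is the structure with universe $\{0,\dots,N\}$, $<$ the natural linear order, $\mathrm{succ}=\{(a,a+1): 0\le a<N\}$, and constants $\mathrm{min}=0$, $\mathrm{max}=N$; the class of linear orders is identified with $\{\mathcal{A}_N : N\in\mathbb{N}\}$ (sentences of signature $\{<\}$ are evaluated in the $\{<\}$-reduct). $\mathrm{FO}^k$ denotes the $k$-variable fragment of first-order logic (formulas using only $k$ distinct variables, which may be requantified). $\mathrm{FO}^3(<,\mathrm{succ},\mathrm{min},\mathrm{max})$ is the set of $\mathrm{FO}^3$-formulas over signature $\{<,\mathrm{succ},\mathrm{min},\mathrm{max}\}$ (binary relation symbols $<,\mathrm{succ}$, constants $\mathrm{min},\mathrm{max}$); $\mathrm{FO}^2(<)$ is the set of $\mathrm{FO}^2$-formulas over signature $\{<\}$. The size $|\varphi|$ of a formula is the number of nodes of its syntax tree (leaves are atomic formulas, inner nodes are Boolean connectives or quantifiers).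 -}

module Defs where

open import Data.Nat using (ℕ; zero; suc; _+_; _*_; _^_; _≤_; _≡ᵇ_; _<ᵇ_)
open import Data.Fin using (Fin; toℕ; fromℕ) renaming (zero to fzero)
open import Data.Fin.Properties using () renaming (_≟_ to _≟ᶠ_)
open import Data.Bool using (Bool; true; false; not; _∧_; _∨_; if_then_else_)
open import Data.List using (List; allFin)
open import Data.Bool.ListAction using (any; all)
open import Data.Product using (Σ; ∃; _×_; _,_)
open import Relation.Nullary using (does)
open import Relation.Binary.PropositionalEquality using (_≡_)

-- The structure A_N: universe {0,…,N} = Fin (suc N).

Elem : ℕ → Set
Elem N = Fin (suc N)

Assign : ℕ → ℕ → Set
Assign k N = Fin k → Elem N

update : ∀ {k N} → Assign k N → Fin k → Elem N → Assign k N
update s i a j = if does (j ≟ᶠ i) then a else s j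

eqᴱ ltᴱ succᴱ : ∀ {N} → Elem N → Elem N → Bool
eqᴱ a b = toℕ a ≡ᵇ toℕ b
ltᴱ a b = toℕ a <ᵇ toℕ b
succᴱ a b = toℕ b ≡ᵇ suc (toℕ a)

data Term3 : Set where
  var  : Fin 3 → Term3
  cmin : Term3
  cmax : Term3

data FO3 : Set where
  _≐_     : Term3 → Term3 → FO3
  _≺_     : Term3 → Term3 → FO3
  succ    : Term3 → Term3 → FO3
  ¬ₒ_     : FO3 → FO3
  _∧ₒ_    : FO3 → FO3 → FO3
  _∨ₒ_    : FO3 → FO3 → FO3
  ∃ₒ      : Fin 3 → FO3 → FO3
  ∀ₒ      : Fin 3 → FO3 → FO3

size3 : FO3 → ℕ
size3 (_ ≐ _)    = 1
size3 (_ ≺ _)    = 1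
size3 (succ _ _) = 1
size3 (¬ₒ φ)     = suc (size3 φ)
size3 (φ ∧ₒ ψ)   = suc (size3 φ + size3 ψ)
size3 (φ ∨ₒ ψ)   = suc (size3 φ + size3 ψ)
size3 (∃ₒ _ φ)   = suc (size3 φ)
size3 (∀ₒ _ φ)   = suc (size3 φ)

freeT3 : Fin 3 → Term3 → Bool
freeT3 i (var j) = does (i ≟ᶠ j)
freeT3 i cmin    = false
freeT3 i cmax    = false

free3 : Fin 3 → FO3 → Bool
free3 i (t ≐ u)    = freeT3 i t ∨ freeT3 i u
free3 i (t ≺ u)    = freeT3 i t ∨ freeT3 i u
free3 i (succ t u) = freeT3 i t ∨ freeT3 i u
free3 i (¬ₒ φ)     = free3 i φ
free3 i (φ ∧ₒ ψ)   = free3 i φ ∨ free3 i ψ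
free3 i (φ ∨ₒ ψ)   = free3 i φ ∨ free3 i ψ
free3 i (∃ₒ j φ)   = if does (i ≟ᶠ j) then false else free3 i φ
free3 i (∀ₒ j φ)   = if does (i ≟ᶠ j) then false else free3 i φ

Sentence3 : FO3 → Set
Sentence3 φ = ∀ i → free3 i φ ≡ false

evalT3 : ∀ {N} → Assign 3 N → Term3 → Elem N
evalT3 s (var i) = s i
evalT3 s cmin    = fzero
evalT3 {N} s cmax = fromℕ N

eval3 : ∀ N → Assign 3 N → FO3 → Bool
eval3 N s (t ≐ u)    = eqᴱ (evalT3 s t) (evalT3 s u)
eval3 N s (t ≺ u)    = ltᴱ (evalT3 s t) (evalT3 s u)
eval3 N s (succ t u) = succᴱ (evalT3 s t) (evalT3 s u)
eval3 N s (¬ₒ φ)     = not (eval3 N s φ)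
eval3 N s (φ ∧ₒ ψ)   = eval3 N s φ ∧ eval3 N s ψ
eval3 N s (φ ∨ₒ ψ)   = eval3 N s φ ∨ eval3 N s ψ
eval3 N s (∃ₒ i φ)   = any (λ a → eval3 N (update s i a) φ) (allFin (suc N))
eval3 N s (∀ₒ i φ)   = all (λ a → eval3 N (update s i a) φ) (allFin (suc N))

-- A_N ⊨ φ for a sentence φ (the assignment is irrelevant for sentences;
-- we use the all-zero one).
_⊨₃_ : ℕ → FO3 → Bool
N ⊨₃ φ = eval3 N (λ _ → fzero) φ

data FO2 : Set where
  _≐_     : Fin 2 → Fin 2 → FO2
  _≺_     : Fin 2 → Fin 2 → FO2
  ¬ₒ_     : FO2 → FO2
  _∧ₒ_    : FO2 → FO2 → FO2
  _∨ₒ_    : FO2 → FO2 → FO2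
  ∃ₒ      : Fin 2 → FO2 → FO2
  ∀ₒ      : Fin 2 → FO2 → FO2

size2 : FO2 → ℕ
size2 (_ ≐ _)    = 1
size2 (_ ≺ _)    = 1
size2 (¬ₒ φ)     = suc (size2 φ)
size2 (φ ∧ₒ ψ)   = suc (size2 φ + size2 ψ)
size2 (φ ∨ₒ ψ)   = suc (size2 φ + size2 ψ)
size2 (∃ₒ _ φ)   = suc (size2 φ)
size2 (∀ₒ _ φ)   = suc (size2 φ)

free2 : Fin 2 → FO2 → Bool
free2 i (j ≐ k)    = does (i ≟ᶠ j) ∨ does (i ≟ᶠ k)
free2 i (j ≺ k)    = does (i ≟ᶠ j) ∨ does (i ≟ᶠ k)
free2 i (¬ₒ φ)     = free2 i φ
free2 i (φ ∧ₒ ψ)   = free2 i φ ∨ free2 i ψ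
free2 i (φ ∨ₒ ψ)   = free2 i φ ∨ free2 i ψ
free2 i (∃ₒ j φ)   = if does (i ≟ᶠ j) then false else free2 i φ
free2 i (∀ₒ j φ)   = if does (i ≟ᶠ j) then false else free2 i φ

Sentence2 : FO2 → Set
Sentence2 φ = ∀ i → free2 i φ ≡ false

eval2 : ∀ N → Assign 2 N → FO2 → Bool
eval2 N s (i ≐ j)    = eqᴱ (s i) (s j)
eval2 N s (i ≺ j)    = ltᴱ (s i) (s j)
eval2 N s (¬ₒ φ)     = not (eval2 N s φ)
eval2 N s (φ ∧ₒ ψ)   = eval2 N s φ ∧ eval2 N s ψ
eval2 N s (φ ∨ₒ ψ)   = eval2 N s φ ∨ eval2 N s ψ
eval2 N s (∃ₒ i φ)   = any (λ a → eval2 N (update s i a) φ) (allFin (suc N))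
eval2 N s (∀ₒ i φ)   = all (λ a → eval2 N (update s i a) φ) (allFin (suc N))

_⊨₂_ : ℕ → FO2 → Bool
N ⊨₂ φ = eval2 N (λ _ → fzero) φ

BigO : (ℕ → ℕ) → (ℕ → ℕ) → Set
BigO f g = ∃ λ c → ∃ λ m₀ → ∀ m → m₀ ≤ m → f m ≤ c * g m

{-# OPTIONS --safe #-}
module Submission where

-- An FO³-sentence ψ of size m cannot distinguish A_N from A_M once
-- N, M > 9m², so the truth of ψ in A_N depends only on min(N, 9m²+1), and an
-- FO²(<)-sentence can test each of these lengths with O(m²) symbols.
--
-- The indistinguishability is a back-and-forth argument which keeps, for every
-- pair of terms, a threshold up to which their distances must agree.  Let c
-- bound the sum of two thresholds between variables and let p be the threshold
-- between a variable and min or max.  A quantifier raises c by 1 and p by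
-- c + 1, a binary connective adds the parameters of both sides, and hence
-- c² + 2p ≤ (3m)² by induction.

open import Defs
open import Data.Nat using (ℕ; zero; suc; _+_; _*_; _∸_; _^_; _⊓_; _≤_; _<_; _≡ᵇ_; _<ᵇ_; _≤?_; z≤n; s≤s)
open import Data.Nat.Properties hiding (_≟_)
open import Data.Nat.Tactic.RingSolver using (solve-∀)
open import Data.Bool using (Bool; true; false; not; _∧_; _∨_; T; if_then_else_)
open import Data.Bool.ListAction using (any; all)
open import Data.Bool.Properties using (T-≡; T-∧)
open import Data.Empty using (⊥; ⊥-elim)
open import Data.Fin using (Fin; toℕ; fromℕ; fromℕ<; punchIn; punchOut) renaming (zero to fzero; suc to fsuc)
open import Data.Fin.Properties using (_≟_; any?; all?; toℕ-fromℕ; toℕ-fromℕ<; toℕ≤pred[n]; punchIn-punchOut; punchInᵢ≢i)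
open import Data.List using (allFin; tabulate)
open import Data.List.Extrema.Nat using (max; xs≤max; max≤v⁺)
open import Data.List.Membership.Propositional using (lose)
open import Data.List.Membership.Propositional.Properties using (∈-allFin)
open import Data.List.Relation.Unary.All using () renaming (lookup to All-lookup; tabulate to All-tabulate)
open import Data.List.Relation.Unary.All.Properties using (all⁺; all⁻; tabulate⁺; tabulate⁻)
open import Data.List.Relation.Unary.Any using (satisfied)
open import Data.List.Relation.Unary.Any.Properties using (any⁺; any⁻)
open import Data.Product using (Σ; ∃; _×_; _,_; proj₁; proj₂)
open import Data.Sum using (_⊎_; inj₁; inj₂)
open import Function using (_∘_; id)
open import Function.Bundles using (Equivalence)
open import Relation.Nullary using (yes; no; contradiction)
open import Relation.Nullary.Decidable using (from-yes; ¬?; _→-dec_; _×-dec_)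
open import Relation.Binary.PropositionalEquality

-- Similarity of distances up to a threshold

-- The signed distances a′ − a and b′ − b are equal, or both exceed d
-- in absolute value with the same sign.
data Sim (d a a′ b b′ : ℕ) : Set where
  same  : a + b′ ≡ a′ + b → Sim d a a′ b b′
  below : a + d < a′ → b + d < b′ → Sim d a a′ b b′
  above : a′ + d < a → b′ + d < b → Sim d a a′ b b′

module _ {d a a′ b b′ : ℕ} where

  sim-swap : Sim d a a′ b b′ → Sim d b b′ a a′
  sim-swap (same e)    = same (trans (+-comm b a′) (trans (sym e) (+-comm a b′)))
  sim-swap (below p q) = below q p
  sim-swap (above p q) = above q p

  sim-sym : Sim d a a′ b b′ → Sim d a′ a b′ b
  sim-sym (same e)    = same (sym e)
  sim-sym (below p q) = above p q
  sim-sym (above p q) = below p q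

  sim-mono : ∀ {d′} → d′ ≤ d → Sim d a a′ b b′ → Sim d′ a a′ b b′
  sim-mono d′≤d (same e)    = same e
  sim-mono d′≤d (below p q) = below (≤-<-trans (+-monoʳ-≤ a d′≤d) p) (≤-<-trans (+-monoʳ-≤ b d′≤d) q)
  sim-mono d′≤d (above p q) = above (≤-<-trans (+-monoʳ-≤ a′ d′≤d) p) (≤-<-trans (+-monoʳ-≤ b′ d′≤d) q)

  sim-≡ : Sim d a a′ b b′ → a ≡ a′ → b ≡ b′
  sim-≡ (same e)    refl = +-cancelˡ-≡ a b b′ (sym e)
  sim-≡ (below p _) refl = contradiction p (m+n≮m a d)
  sim-≡ (above p _) refl = contradiction p (m+n≮m a d)

  sim-< : Sim d a a′ b b′ → a < a′ → b < b′
  sim-< (same e)    a<a′ = +-cancelˡ-< a b b′ (subst (a + b <_) (sym e) (+-monoˡ-< b a<a′))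
  sim-< (below _ q) a<a′ = ≤-<-trans (m≤m+n b d) q
  sim-< (above p _) a<a′ = contradiction (<-trans a<a′ (≤-<-trans (m≤m+n a′ d) p)) (<-irrefl refl)

  -- Since `d` is at least 1, the cases `below` and `above` force a distance of at least 2, so a
  -- successor pair can only fall under `same`.
  sim-suc : 1 ≤ d → Sim d a a′ b b′ → a′ ≡ suc a → b′ ≡ suc b
  sim-suc _   (same e)    refl = +-cancelˡ-≡ a b′ (suc b) (trans e (sym (+-suc a b)))
  sim-suc 1≤d (below p _) refl =
    contradiction (≤-<-trans (subst (_≤ a + d) (+-comm a 1) (+-monoʳ-≤ a 1≤d)) p) (<-irrefl refl)
  sim-suc _   (above p _) refl =
    contradiction (<-trans (n<1+n a) (≤-<-trans (m≤m+n (suc a) d) p)) (<-irrefl refl)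

sim-refl : ∀ {d a b} → Sim d a a b b
sim-refl = same refl

-- Extending two similar configurations by one point

module Extension
  {n : ℕ} (P P′ δ : Fin n → ℕ)
  (base  : ∀ i → Sim (δ i) 0 (P i) 0 (P′ i))
  (pairs : ∀ i j → Sim (suc (δ i + δ j)) (P i) (P j) (P′ i) (P′ j))
  (x : ℕ)
  where

  -- A point within its threshold dictates the offset of x′.
  module _ (i : Fin n) (p≤x+δ : P i ≤ x + δ i) (x≤p+δ : x ≤ P i + δ i) where

    -- Makes the subtraction in `y` exact: either `P i` equals `P′ i`, or `P′ i` exceeds `δ i`,
    -- which already bounds how far `P i` lies above `x`.
    p≤p′+x : P i ≤ P′ i + x
    p≤p′+x with base i
    ... | same e    = subst (_≤ P′ i + x) (trans e (+-identityʳ (P i))) (m≤m+n (P′ i) x)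
    ... | below _ q = ≤-trans p≤x+δ (≤-trans (+-monoʳ-≤ x (<⇒≤ q)) (≤-reflexive (+-comm x (P′ i))))
    ... | above () _

    y : ℕ
    y = (P′ i + x) ∸ P i

    y-eq : P i + y ≡ P′ i + x
    y-eq = m+[n∸m]≡n p≤p′+x

    -- Triangle inequality: `x` and `y` have the same offset, at most `δ i`, from the two copies of
    -- point `i`. Equal distances from `i` to `j` are therefore inherited, and a distance above
    -- `δ i + δ j + 1` leaves more than `δ j`.
    near-sim : ∀ j → Sim (δ j) (P j) x (P′ j) y
    near-sim j with pairs i j
    ... | same e = same (+-cancelˡ-≡ (P i) _ _ (begin
      P i + (P j + y)   ≡⟨ l₁ (P i) (P j) y ⟩
      P j + (P i + y)   ≡⟨ cong (P j +_) y-eq ⟩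
      P j + (P′ i + x)  ≡⟨ +-assoc (P j) (P′ i) x ⟨
      P j + P′ i + x    ≡⟨ cong (_+ x) e ⟨
      P i + P′ j + x    ≡⟨ l₂ (P i) (P′ j) x ⟩
      P i + (x + P′ j)  ∎))
      where
      open ≡-Reasoning
      l₁ : ∀ a b c → a + (b + c) ≡ b + (a + c)
      l₁ = solve-∀
      l₂ : ∀ a b c → a + b + c ≡ a + (c + b)
      l₂ = solve-∀
    ... | below p q = above
      (begin-strict
        x + δ j                ≤⟨ +-monoˡ-≤ (δ j) x≤p+δ ⟩
        P i + δ i + δ j        ≡⟨ +-assoc (P i) (δ i) (δ j) ⟩
        P i + (δ i + δ j)      <⟨ +-monoʳ-< (P i) (n<1+n _) ⟩
        P i + suc (δ i + δ j)  <⟨ p ⟩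
        P j                    ∎)
      (+-cancelˡ-< (P i) _ _ (begin-strict
        P i + (y + δ j)                 ≡⟨ +-assoc (P i) y (δ j) ⟨
        P i + y + δ j                   ≡⟨ cong (_+ δ j) y-eq ⟩
        P′ i + x + δ j                  ≤⟨ +-monoˡ-≤ (δ j) (+-monoʳ-≤ (P′ i) x≤p+δ) ⟩
        P′ i + (P i + δ i) + δ j        ≡⟨ l (P′ i) (P i) (δ i) (δ j) ⟩
        P i + (P′ i + (δ i + δ j))      <⟨ +-monoʳ-< (P i) (+-monoʳ-< (P′ i) (n<1+n _)) ⟩
        P i + (P′ i + suc (δ i + δ j))  <⟨ +-monoʳ-< (P i) q ⟩
        P i + P′ j                      ∎))
      where
      open ≤-Reasoning
      l : ∀ a b c d → a + (b + c) + d ≡ b + (a + (c + d))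
      l = solve-∀
    ... | above p q = below
      (+-cancelʳ-< (δ i) _ _ (begin-strict
        P j + δ j + δ i        ≡⟨ l (P j) (δ j) (δ i) ⟩
        P j + (δ i + δ j)      <⟨ +-monoʳ-< (P j) (n<1+n _) ⟩
        P j + suc (δ i + δ j)  <⟨ p ⟩
        P i                    ≤⟨ p≤x+δ ⟩
        x + δ i                ∎))
      (+-cancelʳ-< (P i + δ i) _ _ (begin-strict
        P′ j + δ j + (P i + δ i)        ≡⟨ l′ (P′ j) (δ j) (P i) (δ i) ⟩
        P i + (P′ j + (δ i + δ j))      <⟨ +-monoʳ-< (P i) (+-monoʳ-< (P′ j) (n<1+n _)) ⟩
        P i + (P′ j + suc (δ i + δ j))  <⟨ +-monoʳ-< (P i) q ⟩
        P i + P′ i                      ≤⟨ +-monoˡ-≤ (P′ i) p≤x+δ ⟩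
        x + δ i + P′ i                  ≡⟨ l″ x (δ i) (P′ i) ⟩
        P′ i + x + δ i                  ≡⟨ cong (_+ δ i) y-eq ⟨
        P i + y + δ i                   ≡⟨ l‴ (P i) y (δ i) ⟩
        y + (P i + δ i)                 ∎))
      where
      open ≤-Reasoning
      l : ∀ a b c → a + b + c ≡ a + (c + b)
      l = solve-∀
      l′ : ∀ a b c d → a + b + (c + d) ≡ c + (a + (d + b))
      l′ = solve-∀
      l″ : ∀ a b c → a + b + c ≡ c + a + b
      l″ = solve-∀
      l‴ : ∀ a b c → a + b + c ≡ b + (a + c)
      l‴ = solve-∀

  -- If x is far from all points, then the least value that is far above
  -- the copies of the points below x is also far below all other copies.
  module _ (far : ∀ i → P i + δ i < x ⊎ x + δ i < P i) where

    lower : Fin n → ℕ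
    lower i with far i
    ... | inj₁ _ = suc (P′ i + δ i)
    ... | inj₂ _ = 0

    z : ℕ
    z = max 0 (tabulate lower)

    lower≤z : ∀ i → lower i ≤ z
    lower≤z = tabulate⁻ (xs≤max 0 (tabulate lower))

    module _ {i : Fin n} (x+δ<p : x + δ i < P i) where

      -- Covers the default 0 in `z`: even if nothing lies below `x`, the copy of an upper point
      -- must leave room above 0.
      δ<p′ : δ i < P′ i
      δ<p′ with base i
      ... | same e     = subst (δ i <_) (trans (sym (+-identityʳ (P i))) (sym e)) (≤-<-trans (m≤n+m (δ i) x) x+δ<p)
      ... | below _ q  = q
      ... | above () _

      -- In the case `same` the room that `x` occupies is copied. In the case `below` the extra 1 in
      -- the threshold of `pairs` is exactly what leaves a place strictly beyond both thresholds.
      gap : ∀ j → P j + δ j < x → suc (P′ j + δ j) + suc (δ i) ≤ P′ i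
      gap j p+δ<x with pairs j i
      ... | same e = +-cancelˡ-≤ (P j) _ _ (begin
        P j + (suc (P′ j + δ j) + suc (δ i))  ≡⟨ l (P j) (P′ j) (δ j) (δ i) ⟩
        suc (suc (P j + δ j) + δ i) + P′ j    ≤⟨ +-monoˡ-≤ (P′ j) (s≤s (+-monoˡ-≤ (δ i) p+δ<x)) ⟩
        suc (x + δ i) + P′ j                  ≤⟨ +-monoˡ-≤ (P′ j) x+δ<p ⟩
        P i + P′ j                            ≡⟨ e ⟨
        P j + P′ i                            ∎)
        where
        open ≤-Reasoning
        l : ∀ a b c d → a + (suc (b + c) + suc d) ≡ suc (suc (a + c) + d) + b
        l = solve-∀
      ... | below _ q = subst (_≤ P′ i) (l (P′ j) (δ j) (δ i)) q
        where
        l : ∀ a b c → suc (a + suc (b + c)) ≡ suc (a + b) + suc c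
        l = solve-∀
      ... | above p _ = contradiction
        (<-trans (≤-<-trans (m≤m+n (P j) (δ j)) p+δ<x) (≤-<-trans (m≤m+n x (δ i)) x+δ<p))
        (<-asym (≤-<-trans (m≤m+n (P i) _) p))

      z+δ<p′ : z + δ i < P′ i
      z+δ<p′ = subst (_≤ P′ i) (+-suc z (δ i))
        (subst (z + suc (δ i) ≤_) (m∸n+n≡m δ<p′)
          (+-monoˡ-≤ (suc (δ i)) (max≤v⁺ z≤n (tabulate⁺ lower≤))))
        where
        lower≤ : ∀ j → lower j ≤ P′ i ∸ suc (δ i)
        lower≤ j with far j
        ... | inj₁ p = m+n≤o⇒m≤o∸n _ (gap j p)
        ... | inj₂ _ = z≤n

    far-sim : ∀ i → Sim (δ i) (P i) x (P′ i) z
    far-sim i with far i | lower≤z i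
    ... | inj₁ p | q = below p q
    ... | inj₂ p | _ = above p (z+δ<p′ p)

  extension : ∃ λ x′ → ∀ i → Sim (δ i) (P i) x (P′ i) x′
  extension with any? (λ i → (P i ≤? x + δ i) ×-dec (x ≤? P i + δ i))
  ... | yes (i , p , q) = y i p q , near-sim i p q
  ... | no ¬near = z far , far-sim far
    where
    far : ∀ i → P i + δ i < x ⊎ x + δ i < P i
    far i with P i ≤? x + δ i | x ≤? P i + δ i
    ... | no p  | _     = inj₂ (≰⇒> p)
    ... | yes _ | no q  = inj₁ (≰⇒> q)
    ... | yes p | yes q = contradiction (i , p , q) ¬near

-- Quantifiers over finite universes and updates of assignments

T⇔→≡ : ∀ {x y} → (T x → T y) → (T y → T x) → x ≡ y
T⇔→≡ {true}  {true}  _ _ = refl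
T⇔→≡ {true}  {false} f _ = ⊥-elim (f _)
T⇔→≡ {false} {true}  _ g = ⊥-elim (g _)
T⇔→≡ {false} {false} _ _ = refl

module _ {n : ℕ} {p : Fin n → Bool} where

  any-allFin⁺ : ∀ i → T (p i) → T (any p (allFin n))
  any-allFin⁺ i pi = any⁺ p (lose (∈-allFin i) pi)

  any-allFin⁻ : T (any p (allFin n)) → ∃ (T ∘ p)
  any-allFin⁻ h = satisfied (any⁻ p (allFin n) h)

  all-allFin⁺ : (∀ i → T (p i)) → T (all p (allFin n))
  all-allFin⁺ h = all⁻ p {xs = allFin n} (All-tabulate (λ {i} _ → h i))

  all-allFin⁻ : T (all p (allFin n)) → ∀ i → T (p i)
  all-allFin⁻ h i = All-lookup (all⁺ p (allFin n) h) (∈-allFin i)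

module _ {m n : ℕ} {p : Fin m → Bool} {q : Fin n → Bool}
  (forth : ∀ i → ∃ λ j → p i ≡ q j) (back : ∀ j → ∃ λ i → p i ≡ q j) where

  any-cong : any p (allFin m) ≡ any q (allFin n)
  any-cong = T⇔→≡
    (λ h → let i , pi = any-allFin⁻ h ; j , e = forth i in any-allFin⁺ j (subst T e pi))
    (λ h → let j , qj = any-allFin⁻ h ; i , e = back j in any-allFin⁺ i (subst T (sym e) qj))

  all-cong : all p (allFin m) ≡ all q (allFin n)
  all-cong = T⇔→≡
    (λ h → all-allFin⁺ λ j → let i , e = back j in subst T e (all-allFin⁻ h i))
    (λ h → all-allFin⁺ λ i → let j , e = forth i in subst T (sym e) (all-allFin⁻ h j))

update-≡ : ∀ {k N} (s : Assign k N) i a → update s i a i ≡ a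
update-≡ s i a with i ≟ i
... | yes _ = refl
... | no ¬p = contradiction refl ¬p

update-≢ : ∀ {k N} (s : Assign k N) {i j} a → j ≢ i → update s i a j ≡ s j
update-≢ s {i} {j} a j≢i with j ≟ i
... | yes p = contradiction p j≢i
... | no _  = refl

-- Thresholds for three variables and two endpoints

-- Thresholds up to which distances must agree: inner for two variables,
-- border for a variable and min or max, and 2·border for min and max.
-- The field centre bounds the sum of any two inner thresholds; it is this
-- sum, plus one, that a quantifier over their common variable hands over
-- to the remaining pair, all other inner thresholds dropping to zero.
record Scale : Set where
  field
    inner   : Fin 3 → Fin 3 → ℕ
    centre  : ℕ
    border  : ℕ
    inner-sym : ∀ i j → inner i j ≡ inner j i
    inner≤centre : ∀ i j → inner i j ≤ centre
    inner+inner≤centre : ∀ {i j k} → i ≢ j → i ≢ k → j ≢ k → inner i j + inner i k ≤ centre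

open Scale

threshold : Scale → Term3 → Term3 → ℕ
threshold S (var i) (var j) = inner S i j
threshold S (var _) cmin    = border S
threshold S (var _) cmax    = border S
threshold S cmin    (var _) = border S
threshold S cmax    (var _) = border S
threshold S cmin    cmin    = border S + border S
threshold S cmin    cmax    = border S + border S
threshold S cmax    cmin    = border S + border S
threshold S cmax    cmax    = border S + border S

threshold-sym : ∀ S t u → threshold S t u ≡ threshold S u t
threshold-sym S (var i) (var j) = inner-sym S i j
threshold-sym S (var _) cmin    = refl
threshold-sym S (var _) cmax    = refl
threshold-sym S cmin    (var _) = refl
threshold-sym S cmax    (var _) = refl
threshold-sym S cmin    cmin    = refl
threshold-sym S cmin    cmax    = refl
threshold-sym S cmax    cmin    = refl
threshold-sym S cmax    cmax    = refl

-- Atoms need threshold 1 because of `succ`; two inner thresholds then sum to 2.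
unit : Scale
unit = record
  { inner = λ _ _ → 1 ; centre = 2 ; border = 1
  ; inner-sym = λ _ _ → refl
  ; inner≤centre = λ _ _ → s≤s z≤n
  ; inner+inner≤centre = λ _ _ _ → ≤-refl }

1≤threshold-unit : ∀ t u → 1 ≤ threshold unit t u
1≤threshold-unit (var _) (var _) = ≤-refl
1≤threshold-unit (var _) cmin    = ≤-refl
1≤threshold-unit (var _) cmax    = ≤-refl
1≤threshold-unit cmin    (var _) = ≤-refl
1≤threshold-unit cmax    (var _) = ≤-refl
1≤threshold-unit cmin    cmin    = s≤s z≤n
1≤threshold-unit cmin    cmax    = s≤s z≤n
1≤threshold-unit cmax    cmin    = s≤s z≤n
1≤threshold-unit cmax    cmax    = s≤s z≤n

+-interchange : ∀ a b c d → (a + b) + (c + d) ≡ (a + c) + (b + d)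
+-interchange = solve-∀

-- Sums instead of maxima: if the two sides quantify different variables, pointwise maxima can
-- violate `inner+inner≤centre` for the larger centre.
_⊕_ : Scale → Scale → Scale
S ⊕ R = record
  { inner = λ i j → inner S i j + inner R i j
  ; centre = centre S + centre R
  ; border = border S + border R
  ; inner-sym = λ i j → cong₂ _+_ (inner-sym S i j) (inner-sym R i j)
  ; inner≤centre = λ i j → +-mono-≤ (inner≤centre S i j) (inner≤centre R i j)
  ; inner+inner≤centre = λ {i} {j} {k} p q r →
      subst (_≤ centre S + centre R) (+-interchange (inner S i j) (inner S i k) (inner R i j) (inner R i k))
        (+-mono-≤ (inner+inner≤centre S p q r) (inner+inner≤centre R p q r)) }

threshold-⊕ : ∀ S R t u → threshold (S ⊕ R) t u ≡ threshold S t u + threshold R t u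
threshold-⊕ S R (var i) (var j) = refl
threshold-⊕ S R (var _) cmin    = refl
threshold-⊕ S R (var _) cmax    = refl
threshold-⊕ S R cmin    (var _) = refl
threshold-⊕ S R cmax    (var _) = refl
threshold-⊕ S R cmin    cmin    = +-interchange (border S) (border R) (border S) (border R)
threshold-⊕ S R cmin    cmax    = +-interchange (border S) (border R) (border S) (border R)
threshold-⊕ S R cmax    cmin    = +-interchange (border S) (border R) (border S) (border R)
threshold-⊕ S R cmax    cmax    = +-interchange (border S) (border R) (border S) (border R)

-- The quantifier overwrites variable `i`, so pairs containing its old value get threshold 0.
avoid : ℕ → Fin 3 → Fin 3 → Fin 3 → ℕ
avoid c i j k with j ≟ i | k ≟ i
... | no _ | no _ = c
... | _    | _    = 0

avoid-≢ : ∀ c {i j k} → j ≢ i → k ≢ i → avoid c i j k ≡ c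
avoid-≢ c {i} {j} {k} j≢i k≢i with j ≟ i | k ≟ i
... | no _  | no _  = refl
... | yes p | _     = contradiction p j≢i
... | no _  | yes p = contradiction p k≢i

avoid-sym : ∀ c i j k → avoid c i j k ≡ avoid c i k j
avoid-sym c i j k with j ≟ i | k ≟ i
... | no _  | no _  = refl
... | yes _ | yes _ = refl
... | yes _ | no _  = refl
... | no _  | yes _ = refl

avoid≤ : ∀ c i j k → avoid c i j k ≤ c
avoid≤ c i j k with j ≟ i | k ≟ i
... | no _  | no _  = ≤-refl
... | yes _ | yes _ = z≤n
... | yes _ | no _  = z≤n
... | no _  | yes _ = z≤n

fin3-exhausted : (i j k l : Fin 3) → j ≢ k → j ≢ l → k ≢ l → j ≢ i → k ≢ i → l ≢ i → ⊥
fin3-exhausted = from-yes (all? λ (i : Fin 3) → all? λ (j : Fin 3) → all? λ (k : Fin 3) → all? λ (l : Fin 3) →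
  ¬? (j ≟ k) →-dec ¬? (j ≟ l) →-dec ¬? (k ≟ l) →-dec
  ¬? (j ≟ i) →-dec ¬? (k ≟ i) →-dec ¬? (l ≟ i) →-dec no id)

-- Here the restriction to three variables enters: `j`, `k`, `l` exhaust them, so one of them is
-- `i`, and at most one of the two pairs avoids it. Hence a quantifier raises the centre by 1 and
-- does not double it.
avoid+avoid≤ : ∀ c i {j k l} → j ≢ k → j ≢ l → k ≢ l → avoid c i j k + avoid c i j l ≤ c
avoid+avoid≤ c i {j} {k} {l} jk jl kl with j ≟ i | k ≟ i | l ≟ i
... | yes _ | _     | _     = z≤n
... | no _  | yes _ | no _  = ≤-refl
... | no _  | yes _ | yes _ = z≤n
... | no _  | no _  | yes _ = ≤-reflexive (+-identityʳ c)
... | no ji | no ki | no li = ⊥-elim (fin3-exhausted i j k l jk jl kl ji ki li)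

-- Dictated by `pairs` in `Extension`: two old points must agree up to one more than the sum of
-- their thresholds to the new point. That sum is at most `centre S` for two distinct variables and
-- `border S + centre S` for a variable and an endpoint.
quantify : Fin 3 → Scale → Scale
quantify i S = record
  { inner = avoid (suc (centre S)) i
  ; centre = suc (centre S)
  ; border = border S + suc (centre S)
  ; inner-sym = avoid-sym (suc (centre S)) i
  ; inner≤centre = avoid≤ (suc (centre S)) i
  ; inner+inner≤centre = avoid+avoid≤ (suc (centre S)) i }

module _ (S : Scale) (i : Fin 3) where

  private
    c p : ℕ
    c = centre S
    p = border S

    border-gap : suc (p + p) ≤ (p + suc c) + (p + suc c)
    border-gap = begin
      suc (p + p)                ≤⟨ m≤m+n (suc (p + p)) (c + suc c) ⟩
      suc (p + p) + (c + suc c)  ≡⟨ l p c ⟩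
      (p + suc c) + (p + suc c)  ∎
      where
      open ≤-Reasoning
      l : ∀ p c → suc (p + p) + (c + suc c) ≡ (p + suc c) + (p + suc c)
      l = solve-∀

    mixed-gap : ∀ j → suc (p + inner S j i) ≤ p + suc c
    mixed-gap j = subst (suc (p + inner S j i) ≤_) (sym (+-suc p c)) (s≤s (+-monoʳ-≤ p (inner≤centre S j i)))

    mixed-gap′ : ∀ j → suc (inner S j i + p) ≤ p + suc c
    mixed-gap′ j = subst (λ n → suc n ≤ p + suc c) (+-comm p (inner S j i)) (mixed-gap j)

  -- Equal terms are split off because, for a single variable, twice its threshold to `var i` can
  -- exceed the centre; there `sim-refl` serves every threshold.
  threshold-gap : ∀ t u → t ≢ var i → u ≢ var i →
    t ≡ u ⊎ suc (threshold S t (var i) + threshold S u (var i)) ≤ threshold (quantify i S) t u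
  threshold-gap cmin    cmin    _ _ = inj₁ refl
  threshold-gap cmax    cmax    _ _ = inj₁ refl
  threshold-gap cmin    cmax    _ _ = inj₂ border-gap
  threshold-gap cmax    cmin    _ _ = inj₂ border-gap
  threshold-gap cmin    (var j) _ _ = inj₂ (mixed-gap j)
  threshold-gap cmax    (var j) _ _ = inj₂ (mixed-gap j)
  threshold-gap (var j) cmin    _ _ = inj₂ (mixed-gap′ j)
  threshold-gap (var j) cmax    _ _ = inj₂ (mixed-gap′ j)
  threshold-gap (var j) (var k) j≢ k≢ with j ≟ k
  ... | yes refl = inj₁ refl
  ... | no j≢k   = inj₂ (subst₂ _≤_
    (cong suc (cong₂ _+_ (inner-sym S i j) (inner-sym S i k)))
    (sym (avoid-≢ (suc c) (j≢ ∘ cong var) (k≢ ∘ cong var)))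
    (s≤s (inner+inner≤centre S (j≢ ∘ cong var ∘ sym) (k≢ ∘ cong var ∘ sym) j≢k)))

  threshold-quantify : ∀ t u → t ≢ var i → u ≢ var i → threshold S t u ≤ threshold (quantify i S) t u
  threshold-quantify (var j) (var k) j≢ k≢ = subst (inner S j k ≤_)
    (sym (avoid-≢ (suc c) (j≢ ∘ cong var) (k≢ ∘ cong var))) (m≤n⇒m≤1+n (inner≤centre S j k))
  threshold-quantify (var _) cmin    _ _ = m≤m+n p (suc c)
  threshold-quantify (var _) cmax    _ _ = m≤m+n p (suc c)
  threshold-quantify cmin    (var _) _ _ = m≤m+n p (suc c)
  threshold-quantify cmax    (var _) _ _ = m≤m+n p (suc c)
  threshold-quantify cmin    cmin    _ _ = <⇒≤ border-gap
  threshold-quantify cmin    cmax    _ _ = <⇒≤ border-gap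
  threshold-quantify cmax    cmin    _ _ = <⇒≤ border-gap
  threshold-quantify cmax    cmax    _ _ = <⇒≤ border-gap

-- Back-and-forth between assignments

⟦_⟧ : ∀ {N} → Term3 → Assign 3 N → ℕ
⟦ t ⟧ s = toℕ (evalT3 s t)

⟦⟧-update-≢ : ∀ {N} (s : Assign 3 N) {i} a t → t ≢ var i → ⟦ t ⟧ (update s i a) ≡ ⟦ t ⟧ s
⟦⟧-update-≢ s a (var j) t≢ = cong toℕ (update-≢ s a (t≢ ∘ cong var))
⟦⟧-update-≢ s a cmin    _  = refl
⟦⟧-update-≢ s a cmax    _  = refl

_≟var_ : ∀ t i → t ≡ var i ⊎ t ≢ var i
var j ≟var i with j ≟ i
... | yes refl = inj₁ refl
... | no j≢i   = inj₂ λ { refl → j≢i refl }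
cmin  ≟var i = inj₂ λ ()
cmax  ≟var i = inj₂ λ ()

Equiv : Scale → ∀ {N M} → Assign 3 N → Assign 3 M → Set
Equiv S s s′ = ∀ t u → Sim (threshold S t u) (⟦ t ⟧ s) (⟦ u ⟧ s) (⟦ t ⟧ s′) (⟦ u ⟧ s′)

equiv-swap : ∀ S {N M} {s : Assign 3 N} {s′ : Assign 3 M} → Equiv S s s′ → Equiv S s′ s
equiv-swap S h t u = sim-swap (h t u)

equiv-⊕ˡ : ∀ S R {N M} {s : Assign 3 N} {s′ : Assign 3 M} → Equiv (S ⊕ R) s s′ → Equiv S s s′
equiv-⊕ˡ S R h t u = sim-mono (≤-trans (m≤m+n _ _) (≤-reflexive (sym (threshold-⊕ S R t u)))) (h t u)

equiv-⊕ʳ : ∀ S R {N M} {s : Assign 3 N} {s′ : Assign 3 M} → Equiv (S ⊕ R) s s′ → Equiv R s s′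
equiv-⊕ʳ S R h t u = sim-mono (≤-trans (m≤n+m _ _) (≤-reflexive (sym (threshold-⊕ S R t u)))) (h t u)

-- The points with which a new value of variable `i` is compared. `cmin` has index 0 and value 0,
-- which yields the hypothesis `base` of `Extension` as a special case of `pairs`.
others : Fin 3 → Fin 4 → Term3
others i fzero           = cmin
others i (fsuc fzero)    = cmax
others i (fsuc (fsuc k)) = var (punchIn i k)

others-≢ : ∀ i k → others i k ≢ var i
others-≢ i fzero           ()
others-≢ i (fsuc fzero)    ()
others-≢ i (fsuc (fsuc k)) e with punchIn i k in eq
others-≢ i (fsuc (fsuc k)) refl | _ = punchInᵢ≢i i k eq

others-surjective : ∀ i t → t ≢ var i → ∃ λ k → others i k ≡ t
others-surjective i cmin    _  = fzero , refl
others-surjective i cmax    _  = fsuc fzero , refl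
others-surjective i (var j) t≢ = fsuc (fsuc (punchOut i≢j)) , cong var (punchIn-punchOut i≢j)
  where
  i≢j : i ≢ j
  i≢j e = t≢ (cong var (sym e))

module _ (S : Scale) (i : Fin 3) {N M : ℕ} {s : Assign 3 N} {s′ : Assign 3 M}
  (h : Equiv (quantify i S) s s′) (a : Elem N) where

  private
    x : ℕ
    x = toℕ a

    point-sim : ∀ k l → Sim (suc (threshold S (others i k) (var i) + threshold S (others i l) (var i)))
      (⟦ others i k ⟧ s) (⟦ others i l ⟧ s) (⟦ others i k ⟧ s′) (⟦ others i l ⟧ s′)
    point-sim k l with threshold-gap S i (others i k) (others i l) (others-≢ i k) (others-≢ i l)
    ... | inj₁ e   = subst (λ u → Sim (suc (threshold S (others i k) (var i) + threshold S (others i l) (var i)))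
      (⟦ others i k ⟧ s) (⟦ u ⟧ s) (⟦ others i k ⟧ s′) (⟦ u ⟧ s′)) e sim-refl
    ... | inj₂ d≤d = sim-mono d≤d (h (others i k) (others i l))

    base-sim : ∀ k → Sim (threshold S (others i k) (var i)) 0 (⟦ others i k ⟧ s) 0 (⟦ others i k ⟧ s′)
    base-sim k = sim-mono (m≤n⇒m≤1+n (m≤n+m _ (border S))) (point-sim fzero k)

    open Extension
      (λ k → ⟦ others i k ⟧ s) (λ k → ⟦ others i k ⟧ s′) (λ k → threshold S (others i k) (var i))
      base-sim point-sim x using (extension)

    x′ : ℕ
    x′ = proj₁ extension

    x′-sim : ∀ t → t ≢ var i → Sim (threshold S t (var i)) (⟦ t ⟧ s) x (⟦ t ⟧ s′) x′
    x′-sim t t≢ with others-surjective i t t≢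
    ... | k , refl = proj₂ extension k

    x≤N : x ≤ toℕ (fromℕ N)
    x≤N = subst (x ≤_) (sym (toℕ-fromℕ N)) (toℕ≤pred[n] a)

    -- `Extension` works in all of ℕ; similarity with `cmax` is what keeps the answer inside the
    -- universe.
    x′<1+M : x′ < suc M
    x′<1+M with x′-sim cmax (λ ())
    ... | same e    = s≤s (subst (x′ ≤_) (toℕ-fromℕ M)
      (+-cancelˡ-≤ x _ _ (≤-trans (+-monoˡ-≤ x′ x≤N) (≤-reflexive e))))
    ... | below q _ = contradiction (≤-<-trans (m≤m+n _ _) q) (≤⇒≯ x≤N)
    ... | above _ q = s≤s (subst (x′ ≤_) (toℕ-fromℕ M) (<⇒≤ (≤-<-trans (m≤m+n x′ _) q)))

    a′ : Elem M
    a′ = fromℕ< x′<1+M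

    new : ∀ {K} (r : Assign 3 K) b → ⟦ var i ⟧ (update r i b) ≡ toℕ b
    new r b = cong toℕ (update-≡ r i b)

    mixed : ∀ t → t ≢ var i → Sim (threshold S t (var i))
      (⟦ t ⟧ (update s i a)) (⟦ var i ⟧ (update s i a)) (⟦ t ⟧ (update s′ i a′)) (⟦ var i ⟧ (update s′ i a′))
    mixed t t≢ rewrite ⟦⟧-update-≢ s a t t≢ | ⟦⟧-update-≢ s′ a′ t t≢
      | new s a | new s′ a′ | toℕ-fromℕ< x′<1+M = x′-sim t t≢

  -- Pairs with `var i` are similar by the choice of the new point; all other pairs keep their
  -- values, and their old threshold is large enough.
  forth : ∃ λ b → Equiv S (update s i a) (update s′ i b)
  forth = a′ , ext
    where
    ext : Equiv S (update s i a) (update s′ i a′)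
    ext t u with t ≟var i | u ≟var i
    ... | inj₁ refl | inj₁ refl = sim-refl
    ... | inj₂ t≢   | inj₁ refl = mixed t t≢
    ... | inj₁ refl | inj₂ u≢   rewrite threshold-sym S (var i) u = sim-sym (mixed u u≢)
    ... | inj₂ t≢   | inj₂ u≢
      rewrite ⟦⟧-update-≢ s a t t≢ | ⟦⟧-update-≢ s′ a′ t t≢
        | ⟦⟧-update-≢ s a u u≢ | ⟦⟧-update-≢ s′ a′ u u≢
      = sim-mono (threshold-quantify S i t u t≢ u≢) (h t u)

-- Formulas cannot distinguish similar assignments

scale : FO3 → Scale
scale (_ ≐ _)    = unit
scale (_ ≺ _)    = unit
scale (succ _ _) = unit
scale (¬ₒ φ)     = scale φ
scale (φ ∧ₒ ψ)   = scale φ ⊕ scale ψ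
scale (φ ∨ₒ ψ)   = scale φ ⊕ scale ψ
scale (∃ₒ i φ)   = quantify i (scale φ)
scale (∀ₒ i φ)   = quantify i (scale φ)

≡ᵇ-mono : ∀ {a b c d} → (a ≡ b → c ≡ d) → T (a ≡ᵇ b) → T (c ≡ᵇ d)
≡ᵇ-mono f = ≡⇒≡ᵇ _ _ ∘ f ∘ ≡ᵇ⇒≡ _ _

<ᵇ-mono : ∀ {a b c d} → (a < b → c < d) → T (a <ᵇ b) → T (c <ᵇ d)
<ᵇ-mono {a} {b} f = <⇒<ᵇ ∘ f ∘ <ᵇ⇒< a b

eval3-cong : ∀ φ {N M} {s : Assign 3 N} {s′ : Assign 3 M} →
  Equiv (scale φ) s s′ → eval3 N s φ ≡ eval3 M s′ φ
eval3-cong (t ≐ u) h = T⇔→≡ (≡ᵇ-mono (sim-≡ (h t u))) (≡ᵇ-mono (sim-≡ (sim-swap (h t u))))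
eval3-cong (t ≺ u) h = T⇔→≡ (<ᵇ-mono (sim-< (h t u))) (<ᵇ-mono (sim-< (sim-swap (h t u))))
eval3-cong (succ t u) h = T⇔→≡
  (≡ᵇ-mono (sim-suc (1≤threshold-unit t u) (h t u)))
  (≡ᵇ-mono (sim-suc (1≤threshold-unit t u) (sim-swap (h t u))))
eval3-cong (¬ₒ φ) h = cong not (eval3-cong φ h)
eval3-cong (φ ∧ₒ ψ) h = cong₂ _∧_
  (eval3-cong φ (equiv-⊕ˡ (scale φ) (scale ψ) h)) (eval3-cong ψ (equiv-⊕ʳ (scale φ) (scale ψ) h))
eval3-cong (φ ∨ₒ ψ) h = cong₂ _∨_
  (eval3-cong φ (equiv-⊕ˡ (scale φ) (scale ψ) h)) (eval3-cong ψ (equiv-⊕ʳ (scale φ) (scale ψ) h))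
eval3-cong (∃ₒ i φ) h = any-cong
  (λ a → let b , g = forth (scale φ) i h a in b , eval3-cong φ g)
  (λ b → let a , g = forth (scale φ) i (equiv-swap (quantify i (scale φ)) h) b in a , sym (eval3-cong φ g))
eval3-cong (∀ₒ i φ) h = all-cong
  (λ a → let b , g = forth (scale φ) i h a in b , eval3-cong φ g)
  (λ b → let a , g = forth (scale φ) i (equiv-swap (quantify i (scale φ)) h) b in a , sym (eval3-cong φ g))

-- Quadratic bound on the thresholds

-- The square root of the weight grows by at most 3 per node: a quantifier adds
-- 4·centre + 3 to the weight, and centre is at most its square root.
weight : Scale → ℕ
weight S = centre S * centre S + (border S + border S)

m*m≤n*n⇒m≤n : ∀ {m n} → m * m ≤ n * n → m ≤ n
m*m≤n*n⇒m≤n h = ≮⇒≥ λ n<m → <⇒≱ (*-mono-< n<m n<m) h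

centre≤ : ∀ S w → weight S ≤ w * w → centre S ≤ w
centre≤ S w h = m*m≤n*n⇒m≤n {centre S} {w} (≤-trans (m≤m+n _ _) h)

-- Borders merely add up; squaring the sum of the centres creates the cross term, which is at most
-- `2 * (v * w)` because each centre is at most the root of its weight bound.
weight-⊕ : ∀ S R v w → weight S ≤ v * v → weight R ≤ w * w → weight (S ⊕ R) ≤ (v + w) * (v + w)
weight-⊕ S R v w hv hw = begin
  weight (S ⊕ R)
    ≡⟨ l (centre S) (border S) (centre R) (border R) ⟩
  weight S + weight R + 2 * (centre S * centre R)
    ≤⟨ +-mono-≤ (+-mono-≤ hv hw) (*-monoʳ-≤ 2 (*-mono-≤ (centre≤ S v hv) (centre≤ R w hw))) ⟩
  v * v + w * w + 2 * (v * w)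
    ≡⟨ l′ v w ⟩
  (v + w) * (v + w)
    ∎
  where
  open ≤-Reasoning
  l : ∀ c p d q → (c + d) * (c + d) + ((p + q) + (p + q))
    ≡ c * c + (p + p) + (d * d + (q + q)) + 2 * (c * d)
  l = solve-∀
  l′ : ∀ v w → v * v + w * w + 2 * (v * w) ≡ (v + w) * (v + w)
  l′ = solve-∀

weight-quantify : ∀ i S w → weight S ≤ w * w → weight (quantify i S) ≤ (3 + w) * (3 + w)
weight-quantify i S w h = begin
  weight (quantify i S)           ≡⟨ l (centre S) (border S) ⟩
  weight S + (4 * centre S + 3)   ≤⟨ +-mono-≤ h (+-monoˡ-≤ 3 (*-monoʳ-≤ 4 (centre≤ S w h))) ⟩
  w * w + (4 * w + 3)             ≤⟨ m≤m+n _ (2 * w + 6) ⟩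
  w * w + (4 * w + 3) + (2 * w + 6) ≡⟨ l′ w ⟩
  (3 + w) * (3 + w)               ∎
  where
  open ≤-Reasoning
  l : ∀ c p → suc c * suc c + ((p + suc c) + (p + suc c)) ≡ c * c + (p + p) + (4 * c + 3)
  l = solve-∀
  l′ : ∀ w → w * w + (4 * w + 3) + (2 * w + 6) ≡ (3 + w) * (3 + w)
  l′ = solve-∀

square-mono : ∀ {m n} → m ≤ n → m * m ≤ n * n
square-mono m≤n = *-mono-≤ m≤n m≤n

weight-binary : ∀ S R m n → weight S ≤ (3 * m) * (3 * m) → weight R ≤ (3 * n) * (3 * n) →
  weight (S ⊕ R) ≤ (3 * suc (m + n)) * (3 * suc (m + n))
weight-binary S R m n hm hn = ≤-trans (weight-⊕ S R (3 * m) (3 * n) hm hn) (square-mono (begin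
  3 * m + 3 * n    ≡⟨ *-distribˡ-+ 3 m n ⟨
  3 * (m + n)      ≤⟨ *-monoʳ-≤ 3 (n≤1+n (m + n)) ⟩
  3 * suc (m + n)  ∎))
  where open ≤-Reasoning

weight-quantifier : ∀ i S m → weight S ≤ (3 * m) * (3 * m) →
  weight (quantify i S) ≤ (3 * suc m) * (3 * suc m)
weight-quantifier i S m h = subst (λ w → weight (quantify i S) ≤ w * w) (sym (*-suc 3 m)) (weight-quantify i S (3 * m) h)

weight-scale : ∀ φ → weight (scale φ) ≤ (3 * size3 φ) * (3 * size3 φ)
-- The weight of `unit` is 2·2 + 1 + 1 = 6, which is 3 less than the square of 3.
weight-scale (_ ≐ _)    = m≤m+n 6 3
weight-scale (_ ≺ _)    = m≤m+n 6 3
weight-scale (succ _ _) = m≤m+n 6 3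
weight-scale (¬ₒ φ)     = ≤-trans (weight-scale φ) (square-mono (*-monoʳ-≤ 3 (n≤1+n (size3 φ))))
weight-scale (φ ∧ₒ ψ)   = weight-binary (scale φ) (scale ψ) (size3 φ) (size3 ψ) (weight-scale φ) (weight-scale ψ)
weight-scale (φ ∨ₒ ψ)   = weight-binary (scale φ) (scale ψ) (size3 φ) (size3 ψ) (weight-scale φ) (weight-scale ψ)
weight-scale (∃ₒ i φ)   = weight-quantifier i (scale φ) (size3 φ) (weight-scale φ)
weight-scale (∀ₒ i φ)   = weight-quantifier i (scale φ) (size3 φ) (weight-scale φ)

-- Stability of truth on long orders

-- All variables sit at min, so only max is at a nonzero distance from anything, and in both orders
-- that distance exceeds every threshold.
zero-equiv : ∀ S {N M} → border S + border S < N → border S + border S < M →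
  Equiv S {N} {M} (λ _ → fzero) (λ _ → fzero)
zero-equiv S {N} {M} hN hM = λ where
    (var _) (var _) → sim-refl
    (var _) cmin    → sim-refl
    cmin    (var _) → sim-refl
    cmin    cmin    → sim-refl
    cmax    cmax    → sim-refl
    (var _) cmax    → below (<N p≤2p) (<M p≤2p)
    cmin    cmax    → below (<N ≤-refl) (<M ≤-refl)
    cmax    (var _) → above (<N p≤2p) (<M p≤2p)
    cmax    cmin    → above (<N ≤-refl) (<M ≤-refl)
  where
  p≤2p : border S ≤ border S + border S
  p≤2p = m≤m+n (border S) (border S)
  <N : ∀ {d} → d ≤ border S + border S → d < toℕ (fromℕ N)
  <N d≤ = subst (_ <_) (sym (toℕ-fromℕ N)) (≤-<-trans d≤ hN)
  <M : ∀ {d} → d ≤ border S + border S → d < toℕ (fromℕ M)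
  <M d≤ = subst (_ <_) (sym (toℕ-fromℕ M)) (≤-<-trans d≤ hM)

⊨₃-stable : ∀ ψ {N M} → (3 * size3 ψ) * (3 * size3 ψ) < N → (3 * size3 ψ) * (3 * size3 ψ) < M →
  (N ⊨₃ ψ) ≡ (M ⊨₃ ψ)
⊨₃-stable ψ hN hM = eval3-cong ψ (zero-equiv (scale ψ) (≤-<-trans 2p≤ hN) (≤-<-trans 2p≤ hM))
  where
  2p≤ : border (scale ψ) + border (scale ψ) ≤ (3 * size3 ψ) * (3 * size3 ψ)
  2p≤ = ≤-trans (m≤n+m _ (centre (scale ψ) * centre (scale ψ))) (weight-scale ψ)

-- Counting elements with two variables

other : Fin 2 → Fin 2
other fzero        = fsuc fzero
other (fsuc fzero) = fzero

≢other : ∀ i → i ≢ other i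
≢other fzero        ()
≢other (fsuc fzero) ()

-- Expresses that at least `k` elements lie above variable `i`. Two variables suffice because an
-- ascending walk only needs its latest point; `i ≐ i` stands for truth.
chain : ℕ → Fin 2 → FO2
chain zero    i = i ≐ i
chain (suc k) i = ∃ₒ (other i) ((i ≺ other i) ∧ₒ chain k (other i))

size-chain : ∀ k i → size2 (chain k i) ≡ 1 + 3 * k
size-chain zero    i = refl
size-chain (suc k) i rewrite size-chain k (other i) = l k
  where
  l : ∀ k → 3 + (1 + 3 * k) ≡ 1 + 3 * suc k
  l = solve-∀

free-chain : ∀ k i → free2 (other i) (chain k i) ≡ false
free-chain zero    fzero        = refl
free-chain zero    (fsuc fzero) = refl
free-chain (suc k) fzero        = refl
free-chain (suc k) (fsuc fzero) = refl

module _ {N : ℕ} where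

  chain⁻ : ∀ k i (s : Assign 2 N) → T (eval2 N s (chain k i)) → toℕ (s i) + k ≤ N
  chain⁻ zero    i s _ = subst (_≤ N) (sym (+-identityʳ (toℕ (s i)))) (toℕ≤pred[n] (s i))
  chain⁻ (suc k) i s h = let a , ha = any-allFin⁻ h ; i<o , hk = Equivalence.to T-∧ ha in
    begin
      toℕ (s i) + suc k                               ≡⟨ +-suc (toℕ (s i)) k ⟩
      suc (toℕ (s i)) + k                             ≡⟨ cong (λ e → suc (toℕ e) + k) (update-≢ s a (≢other i)) ⟨
      suc (toℕ (update s (other i) a i)) + k          ≤⟨ +-monoˡ-≤ k (<ᵇ⇒< (toℕ (update s (other i) a i)) _ i<o) ⟩
      toℕ (update s (other i) a (other i)) + k        ≤⟨ chain⁻ k (other i) (update s (other i) a) hk ⟩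
      N                                               ∎
    where open ≤-Reasoning

  chain⁺ : ∀ k i (s : Assign 2 N) → toℕ (s i) + k ≤ N → T (eval2 N s (chain k i))
  chain⁺ zero    i s _ = ≡⇒≡ᵇ (toℕ (s i)) _ refl
  chain⁺ (suc k) i s h = any-allFin⁺ a (Equivalence.from T-∧ (<⇒<ᵇ i<o , chain⁺ k (other i) _ o+k≤N))
    where
    h′ : suc (toℕ (s i)) + k ≤ N
    h′ = subst (_≤ N) (+-suc (toℕ (s i)) k) h
    i<1+N : suc (toℕ (s i)) < suc N
    i<1+N = s≤s (≤-trans (m≤m+n _ k) h′)
    -- The immediate successor leaves the most room for the remaining `k` steps.
    a : Elem N
    a = fromℕ< i<1+N
    a-new : toℕ (update s (other i) a (other i)) ≡ suc (toℕ (s i))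
    a-new = trans (cong toℕ (update-≡ s (other i) a)) (toℕ-fromℕ< i<1+N)
    i<o : toℕ (update s (other i) a i) < toℕ (update s (other i) a (other i))
    i<o = subst₂ _<_ (sym (cong toℕ (update-≢ s a (≢other i)))) (sym a-new) (n<1+n _)
    o+k≤N : toℕ (update s (other i) a (other i)) + k ≤ N
    o+k≤N = subst (λ n → n + k ≤ N) (sym a-new) h′

-- Positions are counted from 0, so atLeast k says N ≥ k, i.e. that there
-- are more than k elements.
atLeast : ℕ → FO2
atLeast k = ∃ₒ fzero (chain k fzero)

size-atLeast : ∀ k → size2 (atLeast k) ≡ 2 + 3 * k
size-atLeast k = cong suc (size-chain k fzero)

closed-atLeast : ∀ k → Sentence2 (atLeast k)
closed-atLeast k fzero        = refl
closed-atLeast k (fsuc fzero) = free-chain k fzero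

atLeast-true : ∀ {k N} s → k ≤ N → eval2 N s (atLeast k) ≡ true
atLeast-true {k} {N} s k≤N = Equivalence.to T-≡
  (any-allFin⁺ {p = λ a → eval2 N (update s fzero a) (chain k fzero)} fzero
     (chain⁺ k fzero (update s fzero fzero) k≤N))

atLeast-false : ∀ {k N} s → N < k → eval2 N s (atLeast k) ≡ false
atLeast-false {k} {N} s N<k with eval2 N s (atLeast k) in eq
... | false = refl
... | true with any-allFin⁻ (Equivalence.from T-≡ eq)
... | a , ha = contradiction (≤-trans (m≤n+m k _) (chain⁻ k fzero (update s fzero a) ha)) (<⇒≱ N<k)

-- Testing finitely many lengths

module _ (P : ℕ → Bool) where

  -- A decision list from the largest length down: `atLeast (suc n)` fixes the answer `P (suc n)`
  -- for all longer orders as well, and shorter ones fall through. At the bottom, `atLeast 0` stands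
  -- for truth.
  lengthTest : ℕ → FO2
  lengthTest zero    = if P 0 then atLeast 0 else ¬ₒ atLeast 0
  lengthTest (suc n) = if P (suc n) then atLeast (suc n) ∨ₒ lengthTest n
                                    else (¬ₒ atLeast (suc n)) ∧ₒ lengthTest n

  closed-lengthTest : ∀ n → Sentence2 (lengthTest n)
  closed-lengthTest zero i with P 0
  ... | true  = closed-atLeast 0 i
  ... | false = closed-atLeast 0 i
  closed-lengthTest (suc n) i with P (suc n)
  ... | true  = cong₂ _∨_ (closed-atLeast (suc n) i) (closed-lengthTest n i)
  ... | false = cong₂ _∨_ (closed-atLeast (suc n) i) (closed-lengthTest n i)

  -- Each of the `n` levels above the bottom costs at most `4 + 3 * n`: the test itself, a
  -- connective and possibly a negation.
  size-lengthTest : ∀ n → size2 (lengthTest n) ≤ 3 + n * (4 + 3 * n)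
  size-lengthTest zero with P 0
  ... | true  = n≤1+n 2
  ... | false = ≤-refl
  size-lengthTest (suc n) = ≤-trans step (≤-trans (+-monoʳ-≤ (2 + size2 (atLeast (suc n))) (size-lengthTest n)) bound)
    where
    step : size2 (lengthTest (suc n)) ≤ 2 + size2 (atLeast (suc n)) + size2 (lengthTest n)
    step with P (suc n)
    ... | true  = n≤1+n _
    ... | false = ≤-refl
    open ≤-Reasoning
    l : ∀ n → (2 + (2 + 3 * suc n)) + (3 + n * (4 + 3 * n)) + 3 * n ≡ 3 + suc n * (4 + 3 * suc n)
    l = solve-∀
    bound : 2 + size2 (atLeast (suc n)) + (3 + n * (4 + 3 * n)) ≤ 3 + suc n * (4 + 3 * suc n)
    bound = begin
      2 + size2 (atLeast (suc n)) + (3 + n * (4 + 3 * n))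
        ≡⟨ cong (λ k → 2 + k + (3 + n * (4 + 3 * n))) (size-atLeast (suc n)) ⟩
      (2 + (2 + 3 * suc n)) + (3 + n * (4 + 3 * n))
        ≤⟨ m≤m+n _ (3 * n) ⟩
      (2 + (2 + 3 * suc n)) + (3 + n * (4 + 3 * n)) + 3 * n
        ≡⟨ l n ⟩
      3 + suc n * (4 + 3 * suc n)
        ∎

  eval-lengthTest : ∀ n N s → eval2 N s (lengthTest n) ≡ P (N ⊓ n)
  eval-lengthTest zero N s rewrite ⊓-zeroʳ N with P 0
  ... | true  = atLeast-true {0} s z≤n
  ... | false = cong not (atLeast-true {0} s z≤n)
  eval-lengthTest (suc n) N s with suc n ≤? N
  ... | yes n<N rewrite m≥n⇒m⊓n≡n n<N with P (suc n)
  ...   | true  = cong (_∨ eval2 N s (lengthTest n)) (atLeast-true s n<N)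
  ...   | false = cong (λ b → not b ∧ eval2 N s (lengthTest n)) (atLeast-true s n<N)
  eval-lengthTest (suc n) N s | no n≮N = trans drop (trans (eval-lengthTest n N s) (cong P N⊓n≡N⊓1+n))
    where
    N≤n : N ≤ n
    N≤n = ≮⇒≥ n≮N
    N⊓n≡N⊓1+n : N ⊓ n ≡ N ⊓ suc n
    N⊓n≡N⊓1+n = trans (m≤n⇒m⊓n≡m N≤n) (sym (m≤n⇒m⊓n≡m (m≤n⇒m≤1+n N≤n)))
    drop : eval2 N s (lengthTest (suc n)) ≡ eval2 N s (lengthTest n)
    drop with P (suc n)
    ... | true  = cong (_∨ eval2 N s (lengthTest n)) (atLeast-false s (s≤s N≤n))
    ... | false = cong (λ b → not b ∧ eval2 N s (lengthTest n)) (atLeast-false s (s≤s N≤n))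

-- The cutoff length and the quartic bound

-- The first length to which `⊨₃-stable` applies, so it represents all longer orders.
cutoff : ℕ → ℕ
cutoff m = suc ((3 * m) * (3 * m))

⊨₃-cutoff : ∀ ψ N → ((N ⊓ cutoff (size3 ψ)) ⊨₃ ψ) ≡ (N ⊨₃ ψ)
⊨₃-cutoff ψ N with N ≤? cutoff (size3 ψ)
... | yes N≤ = cong (_⊨₃ ψ) (m≤n⇒m⊓n≡m N≤)
... | no N≰  = trans (cong (_⊨₃ ψ) (m≥n⇒m⊓n≡n (<⇒≤ (≰⇒> N≰))))
  (⊨₃-stable ψ ≤-refl (<-trans ≤-refl (≰⇒> N≰)))

bound : ℕ → ℕ
bound m = 3 + cutoff m * (4 + 3 * cutoff m)

bound-O : BigO bound (λ m → m ^ 4)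
-- The bound expands to 10 + 90·m² + 243·m⁴, and 10 + 90 + 243 = 343; `m` is at least 1 so that
-- lower powers are dominated by m⁴.
bound-O = 343 , 1 , λ m 1≤m → bound≤ m (*-mono-≤ 1≤m 1≤m)
  where
  open ≤-Reasoning
  l : ∀ m → 3 + suc ((3 * m) * (3 * m)) * (4 + 3 * suc ((3 * m) * (3 * m)))
    ≡ 10 * 1 + (90 * (m * m * 1) + 243 * ((m * m) * (m * m)))
  l = solve-∀
  l′ : ∀ m → 10 * ((m * m) * (m * m)) + (90 * ((m * m) * (m * m)) + 243 * ((m * m) * (m * m)))
    ≡ 343 * (m * (m * (m * (m * 1))))
  l′ = solve-∀
  bound≤ : ∀ m → 1 ≤ m * m → bound m ≤ 343 * m ^ 4
  bound≤ m 1≤m² = begin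
    bound m
      ≡⟨ l m ⟩
    10 * 1 + (90 * (m * m * 1) + 243 * ((m * m) * (m * m)))
      ≤⟨ +-mono-≤ (*-monoʳ-≤ 10 (*-mono-≤ 1≤m² 1≤m²))
           (+-monoˡ-≤ _ (*-monoʳ-≤ 90 (*-monoʳ-≤ (m * m) 1≤m²))) ⟩
    10 * ((m * m) * (m * m)) + (90 * ((m * m) * (m * m)) + 243 * ((m * m) * (m * m)))
      ≡⟨ l′ m ⟩
    343 * m ^ 4
      ∎

theorem4p3 : Σ (ℕ → ℕ) λ f → BigO f (λ m → m ^ 4) × ((ψ : FO3) → Sentence3 ψ → Σ FO2 λ χ → Sentence2 χ × size2 χ ≤ f (size3 ψ) × ((N : ℕ) → (N ⊨₂ χ) ≡ (N ⊨₃ ψ)))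
theorem4p3 = bound , bound-O , λ ψ _ →
  let n = cutoff (size3 ψ)
      P = _⊨₃ ψ
  in lengthTest P n , closed-lengthTest P n , size-lengthTest P n ,
     λ N → trans (eval-lengthTest P n N (λ _ → fzero)) (⊨₃-cutoff ψ N)
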